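{- Let $n\ge 2$ and $0\le k\le n-2$. The number of different types of codimension $k$ faces of the associahedron $K_n$ equals $p_{k+1}(n-1)$, the number of partitions of $n-1$ into exactly $k+1$ positive integer parts. More precisely, the types correspond bijectively to such partitions: a codimension $k$ face represented by an $(n+1)$-gon dissected by $k$ non-crossing diagonals into $k+1$ cells with $j_1,\dots,j_{k+1}$ sides corresponds to the partition $n-1=n_1+\cdots+n_{k+1}$ with $n_i=j_i-2$, and this face is the polytope $K_{n_1+1}\times\cdots\times K_{n_{k+1}+1}=K_{j_1-1}\times\cdots\times K_{j_{k+1}-1}$.
   Context: The associahedron $K_n$ is a convex polytope of dimension $n-2$ whose codimension $k$ faces correspond to the ways of placing $k$ pairwise non-crossing diagonals in a convex $(n+1)$-gon (face inclusion corresponds to adding diagonals). $K_2$ is a point, $K_3$ a segment, $K_4$ a pentagon. The $k$ diagonals dissect the $(n+1)$-gon into $k+1$ regions called cells; a face whose dissection has cells with $j_1,\dots,j_{k+1}$ sides is (combinatorially) the product $K_{j_1-1}\times\cdots\times K_{j_{k+1}-1}$. Two faces are of the same type if their corresponding faces are the same polytope. $p_k(n)$ denotes the number of ways to write $n=n_1+\cdots+n_k$ with positive integers $n_i$, disregarding order. -}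

module Defs where

open import Data.Nat using (ℕ; zero; suc; _+_; _∸_; _≤_; _<_; _≤ᵇ_; _<ᵇ_; _≡ᵇ_)
open import Data.Bool using (Bool; true; false; _∧_; not)
open import Data.List using (List; []; _∷_; length; map; upTo; filterᵇ)
open import Data.Bool.ListAction using (any)
open import Data.Nat.ListAction using (sum)
open import Data.List.Relation.Unary.All using (All)
open import Data.List.Relation.Unary.AllPairs using (AllPairs)
open import Data.Product using (_×_; _,_)
open import Data.Sum using (_⊎_)
open import Relation.Nullary using (¬_)
open import Relation.Binary.PropositionalEquality using (_≡_; _≢_)

-- The convex (n+1)-gon has vertices 0, 1, ..., n in cyclic order.
-- A chord is a pair (a , b) of vertices with a < b.
Chord : Set
Chord = ℕ × ℕ

IsDiagonal : ℕ → Chord → Set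
IsDiagonal n (a , b) = suc a < b × b ≤ n × ¬ (a ≡ 0 × b ≡ n)

Crosses : Chord → Chord → Set
Crosses (a , b) (c , d) = (a < c × c < b × b < d) ⊎ (c < a × a < d × d < b)

-- A set of k pairwise distinct, pairwise non-crossing diagonals of the
-- (n+1)-gon, i.e. a codimension k face of the associahedron K_n.
record Dissection (n k : ℕ) : Set where
  field
    diagonals   : List Chord
    size        : length diagonals ≡ k
    distinct    : AllPairs _≢_ diagonals
    areDiags    : All (IsDiagonal n) diagonals
    nonCrossing : AllPairs (λ x y → ¬ Crosses x y) diagonals
open Dissection public

hiddenBy : Chord → ℕ → Chord → Bool
hiddenBy (a , b) v (c , d) =
  (a ≤ᵇ c) ∧ (d ≤ᵇ b) ∧ (c <ᵇ v) ∧ (v <ᵇ d) ∧ not ((a ≡ᵇ c) ∧ (b ≡ᵇ d))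

-- Every cell of a dissection is the region lying directly below exactly one
-- chord (a , b) (a diagonal, or the side (0 , n) for the root cell); its
-- vertices are a, b and those vertices strictly between a and b that are not
-- hidden by any other diagonal nested in (a , b).
cellSides : List Chord → Chord → ℕ
cellSides D (a , b) =
  2 + length (filterᵇ (λ v → not (any (hiddenBy (a , b) v) D))
                      (map (λ i → suc a + i) (upTo (b ∸ suc a))))

cells : ∀ {n k} → Dissection n k → List ℕ
cells {n} Δ = map (cellSides (diagonals Δ)) ((0 , n) ∷ diagonals Δ)

-- Type of the face: the multiset {j_1, ..., j_{k+1}} of cell side counts
-- (the face is K_{j_1 - 1} × ... × K_{j_{k+1} - 1}); two faces have the same
-- type iff their cell lists agree up to permutation.
partitionOf : ∀ {n k} → Dissection n k → List ℕ
partitionOf Δ = map (λ j → j ∸ 2) (cells Δ)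

-- xs is (a listing of) a partition of m into exactly p positive parts;
-- partitions are lists considered up to permutation (_↭_).
IsPartition : ℕ → ℕ → List ℕ → Set
IsPartition m p xs = All (0 <_) xs × length xs ≡ p × sum xs ≡ m

{-# OPTIONS --safe #-}
-- A vertex v is visible from a chord (a , b), a diagonal of the dissection or the
-- side (0 , n), if a < v < b and no other chord nested in (a , b) passes over v.  The
-- vertices visible from (a , b) are those of the cell below it other than a and b, so
-- there are n_i = j_i - 2 of them.  Every inner vertex 0 < v < n is visible from
-- exactly one chord: from the shortest chord over it, and from no other, since two
-- chords over v do not cross, hence are nested, and the inner one hides v from the
-- outer one.  Counting the pairs (chord, visible vertex) both ways gives
-- n_1 + ... + n_{k+1} = n - 1, and n_i > 0 because the far end of the last chord from
-- a ending before b (or a + 1 if there is none) is visible from (a , b).  Conversely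
-- the diagonals (0 , 1 + n_{i+1} + ... + n_{k+1}), i = 1 .. k, realise any partition.
-- Finally j_i = n_i + 2, so cell lists agree up to order when the partitions do.

module Submission where

open import Defs
open import Level using (Level)
open import Function using (_∘_; id; _⇔_; mk⇔; Equivalence)
open import Data.Empty using (⊥-elim)
open import Data.Unit using (tt)
open import Data.Bool using (Bool; true; false; not; T; if_then_else_)
open import Data.Bool.ListAction using (any)
open import Data.Nat
open import Data.Nat.Properties
open import Data.Nat.ListAction using (sum)
open import Data.Nat.ListAction.Properties using (sum-++)
open import Data.Product using (_×_; _,_; proj₁; proj₂; Σ; ∃)
open import Data.Product.Properties using (≡-dec)
open import Data.Sum using (_⊎_; inj₁; inj₂; [_,_]′)
open import Data.List using (List; []; _∷_; _++_; map; length; filter; upTo; applyUpTo)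
open import Data.List.Properties
  using ( map-++; map-∘; map-cong; map-cong-local; map-upTo; length-map; length-upTo
        ; filter-none; filter-some; filter-all)
open import Data.List.Extrema.Nat
  using ( argmin; argmin-sel; argmin-all; f[argmin]≤f[xs]
        ; argmax; argmax-sel; argmax-all; f[⊥]≤f[argmax]; f[xs]≤f[argmax])
open import Data.List.Membership.Propositional using (_∈_; _∉_; lose)
open import Data.List.Membership.Propositional.Properties using (∈-filter⁺; ∈-filter⁻; ∈-upTo⁺; ∈-map⁺)
open import Data.List.Relation.Unary.All as All using (All; []; _∷_)
open import Data.List.Relation.Unary.All.Properties
  using (map⁺; all-filter; all-upTo; applyUpTo⁺₁; applyUpTo⁺₂; ¬Any⇒All¬; All¬⇒¬Any)
open import Data.List.Relation.Unary.Any using (Any; here; there)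
open import Data.List.Relation.Unary.Any.Properties using (any⁺; any⁻)
open import Data.List.Relation.Unary.AllPairs as AllPairs using (AllPairs; []; _∷_)
import Data.List.Relation.Unary.AllPairs.Properties as AllPairs
open import Data.List.Relation.Unary.Unique.Propositional using (Unique)
open import Data.List.Relation.Binary.Permutation.Propositional using (_↭_; ↭-reflexive)
open import Data.List.Relation.Binary.Permutation.Propositional.Properties using () renaming (map⁺ to ↭-map⁺)
open import Relation.Unary using (Pred; Decidable; ∁)
open import Relation.Nullary using (¬_; Dec; does; yes; no)
open import Relation.Nullary.Decidable using (T?; _×-dec_; ¬?; dec-true; dec-false; does-⇔)
open import Relation.Binary using (Rel; Reflexive; Symmetric; tri<; tri≈; tri>)
open import Relation.Binary.PropositionalEquality
open import Algebra.Properties.CommutativeSemigroup +-commutativeSemigroup using (interchange)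

private variable
  ℓ ℓ′ ℓᵃ ℓᵇ : Level
  A : Set ℓᵃ
  B : Set ℓᵇ

sum-map-+ : (f g : A → ℕ) (xs : List A) →
  sum (map (λ x → f x + g x) xs) ≡ sum (map f xs) + sum (map g xs)
sum-map-+ f g [] = refl
sum-map-+ f g (x ∷ xs) = trans (cong (f x + g x +_) (sum-map-+ f g xs)) (interchange (f x) (g x) _ _)

sum-map-zero : (xs : List A) → sum (map (λ _ → 0) xs) ≡ 0
sum-map-zero [] = refl
sum-map-zero (x ∷ xs) = sum-map-zero xs

sum-map-comm : (f : A → B → ℕ) (xs : List A) (ys : List B) →
  sum (map (λ x → sum (map (f x) ys)) xs) ≡ sum (map (λ y → sum (map (λ x → f x y) xs)) ys)
sum-map-comm f [] ys = sym (sum-map-zero ys)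
sum-map-comm f (x ∷ xs) ys = trans (cong (sum (map (f x) ys) +_) (sum-map-comm f xs ys))
  (sym (sum-map-+ (f x) (λ y → sum (map (λ x → f x y) xs)) ys))

indicator : {P : Set ℓ} → Dec P → ℕ
indicator P? = if does P? then 1 else 0

count : {P : Pred A ℓ} → Decidable P → List A → ℕ
count P? xs = sum (map (indicator ∘ P?) xs)

module _ {P : Pred A ℓ} (P? : Decidable P) where

  length-filter≡count : (xs : List A) → length (filter P? xs) ≡ count P? xs
  length-filter≡count [] = refl
  length-filter≡count (x ∷ xs) with does (P? x)
  ... | true = cong suc (length-filter≡count xs)
  ... | false = length-filter≡count xs

  count-++ : (xs ys : List A) → count P? (xs ++ ys) ≡ count P? xs + count P? ys
  count-++ xs ys = trans (cong sum (map-++ (indicator ∘ P?) xs ys)) (sum-++ (map _ xs) _)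

  count-none : {xs : List A} → All (∁ P) xs → count P? xs ≡ 0
  count-none {xs} ¬P = trans (sym (length-filter≡count xs)) (cong length (filter-none P? ¬P))

  count-all : {xs : List A} → All P xs → count P? xs ≡ length xs
  count-all {xs} Ps = trans (sym (length-filter≡count xs)) (cong length (filter-all P? Ps))

  count-pos : {xs : List A} → Any P xs → 0 < count P? xs
  count-pos {xs} some = subst (0 <_) (length-filter≡count xs) (filter-some P? some)

  count-unique : {xs : List A} {x : A} → Unique xs → x ∈ xs → P x →
                 (∀ {y} → y ∈ xs → P y → y ≡ x) → count P? xs ≡ 1
  count-unique {y ∷ ys} (y∉ys ∷ _) (here refl) Py only rewrite dec-true (P? y) Py =
    cong suc (count-none (All.tabulate λ z∈ys Pz → All.lookup y∉ys z∈ys (sym (only (there z∈ys) Pz))))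
  count-unique {y ∷ ys} (y∉ys ∷ !ys) (there x∈ys) Px only
    rewrite dec-false (P? y) (λ Py → All.lookup y∉ys x∈ys (only (here refl) Py)) =
    count-unique !ys x∈ys Px (only ∘ there)

count-cong : {P : Pred A ℓ} {Q : Pred A ℓ′} (P? : Decidable P) (Q? : Decidable Q) {xs : List A} →
             All (λ x → P x ⇔ Q x) xs → count P? xs ≡ count Q? xs
count-cong P? Q? = cong sum ∘ map-cong-local ∘ All.map λ {x} P⇔Q →
  cong (λ b → if b then 1 else 0) (does-⇔ P⇔Q (P? x) (Q? x))

applyUpTo-+ : (f : ℕ → A) (m n : ℕ) → applyUpTo f (m + n) ≡ applyUpTo f m ++ applyUpTo (f ∘ (m +_)) n
applyUpTo-+ f zero n = refl
applyUpTo-+ f (suc m) n = cong (f 0 ∷_) (applyUpTo-+ (f ∘ suc) m n)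

Inside : Chord → ℕ → Set
Inside (a , b) v = a < v × v < b

inside? : ∀ C → Decidable (Inside C)
inside? (a , b) v = a <? v ×-dec v <? b

window : Chord → List ℕ
window (a , b) = map (suc a +_) (upTo (b ∸ suc a))

count-upTo : {P : Pred ℕ ℓ} (P? : Decidable P) {a b N : ℕ} → a < b → b ≤ N →
             (∀ {v} → P v → Inside (a , b) v) → count P? (upTo N) ≡ count P? (window (a , b))
count-upTo {P = P} P? {a} {b} {N} a<b b≤N P⇒Inside = begin
  count P? (upTo N)
    ≡⟨ cong (count P? ∘ upTo) N≡ ⟨
  count P? (upTo (suc a + (m + r)))
    ≡⟨ cong (count P?) (trans (applyUpTo-+ id (suc a) (m + r))
                              (cong (upTo (suc a) ++_) (applyUpTo-+ (suc a +_) m r))) ⟩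
  count P? (upTo (suc a) ++ (applyUpTo (suc a +_) m ++ above))
    ≡⟨ trans (count-++ P? (upTo (suc a)) _)
             (cong (count P? (upTo (suc a)) +_) (count-++ P? (applyUpTo (suc a +_) m) above)) ⟩
  count P? (upTo (suc a)) + (count P? (applyUpTo (suc a +_) m) + count P? above)
    ≡⟨ cong₂ (λ x y → x + (count P? (applyUpTo (suc a +_) m) + y))
             (count-none P? below-none) (count-none P? above-none) ⟩
  count P? (applyUpTo (suc a +_) m) + 0
    ≡⟨ trans (+-identityʳ _) (cong (count P?) (sym (map-upTo (suc a +_) m))) ⟩
  count P? (window (a , b)) ∎
  where
  open ≡-Reasoning
  m r : ℕ
  m = b ∸ suc a
  r = N ∸ b
  b≡ : suc a + m ≡ b
  b≡ = m+[n∸m]≡n a<b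
  N≡ : suc a + (m + r) ≡ N
  N≡ = trans (sym (+-assoc (suc a) m r)) (trans (cong (_+ r) b≡) (m+[n∸m]≡n b≤N))
  above : List ℕ
  above = applyUpTo (λ i → suc a + (m + i)) r
  below-none : All (∁ P) (upTo (suc a))
  below-none = All.map (λ v<1+a Pv → <⇒≱ (proj₁ (P⇒Inside Pv)) (s≤s⁻¹ v<1+a)) (all-upTo (suc a))
  above-none : All (∁ P) above
  above-none = applyUpTo⁺₂ _ r λ i Pv → <⇒≱ (proj₂ (P⇒Inside Pv))
    (subst (_≤ suc a + (m + i)) b≡ (+-monoʳ-≤ (suc a) (m≤m+n m i)))

window-inside : {a b : ℕ} → a < b → All (Inside (a , b)) (window (a , b))
window-inside {a} {b} a<b = map⁺ (applyUpTo⁺₁ id _ λ {i} i<m →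
  s≤s (m≤m+n a i) , subst (suc a + i <_) (m+[n∸m]≡n a<b) (+-monoʳ-< (suc a) i<m))

count-inside : {a b N : ℕ} → a < b → b ≤ N → count (inside? (a , b)) (upTo N) ≡ b ∸ suc a
count-inside {a} {b} {N} a<b b≤N = begin
  count (inside? (a , b)) (upTo N)          ≡⟨ count-upTo (inside? (a , b)) a<b b≤N id ⟩
  count (inside? (a , b)) (window (a , b))  ≡⟨ count-all (inside? (a , b)) (window-inside a<b) ⟩
  length (map (suc a +_) (upTo (b ∸ suc a))) ≡⟨ length-map (suc a +_) (upTo (b ∸ suc a)) ⟩
  length (upTo (b ∸ suc a))                 ≡⟨ length-upTo (b ∸ suc a) ⟩
  b ∸ suc a                                 ∎
  where open ≡-Reasoning

T-not⇔¬T : ∀ {b} → T (not b) ⇔ (¬ T b)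
T-not⇔¬T {false} = mk⇔ (λ _ ()) (λ _ → tt)
T-not⇔¬T {true} = mk⇔ (λ ()) (λ ¬T → ¬T tt)

T-does⇔ : {P : Set ℓ} (P? : Dec P) → T (does P?) ⇔ P
T-does⇔ (yes p) = mk⇔ (λ _ → p) (λ _ → tt)
T-does⇔ (no ¬p) = mk⇔ (λ ()) ¬p

allPairs-lookup : {R : Rel A ℓ} {xs : List A} {x y : A} → Reflexive R → Symmetric R →
                  AllPairs R xs → x ∈ xs → y ∈ xs → R x y
allPairs-lookup R-refl R-sym (_ ∷ _) (here refl) (here refl) = R-refl
allPairs-lookup R-refl R-sym (Rx ∷ _) (here refl) (there y∈xs) = All.lookup Rx y∈xs
allPairs-lookup R-refl R-sym (Rx ∷ _) (there x∈xs) (here refl) = R-sym (All.lookup Rx x∈xs)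
allPairs-lookup R-refl R-sym (_ ∷ Rxs) (there x∈xs) (there y∈xs) =
  allPairs-lookup R-refl R-sym Rxs x∈xs y∈xs

Crosses-irrefl : ∀ {C} → ¬ Crosses C C
Crosses-irrefl (inj₁ (a<a , _)) = <-irrefl refl a<a
Crosses-irrefl (inj₂ (a<a , _)) = <-irrefl refl a<a

Crosses-sym : Symmetric Crosses
Crosses-sym (inj₁ crossing) = inj₂ crossing
Crosses-sym (inj₂ crossing) = inj₁ crossing

Nested : Chord → Chord → Set
Nested (c , d) (a , b) = a ≤ c × d ≤ b

nested-or-crossing : ∀ {C C′ v} → Inside C v → Inside C′ v → ¬ Crosses C C′ →
                     Nested C C′ ⊎ Nested C′ C
nested-or-crossing {a , b} {c , d} (a<v , v<b) (c<v , v<d) ¬cross with <-cmp a c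
... | tri≈ _ refl _ = [ (λ d≤b → inj₂ (≤-refl , d≤b)) , (λ b≤d → inj₁ (≤-refl , b≤d)) ]′
                        (≤-total d b)
... | tri< a<c _ _ = inj₂ (<⇒≤ a<c , ≮⇒≥ λ b<d → ¬cross (inj₁ (a<c , <-trans c<v v<b , b<d)))
... | tri> _ _ c<a = inj₁ (<⇒≤ c<a , ≮⇒≥ λ d<b → ¬cross (inj₂ (c<a , <-trans a<v v<d , d<b)))

length-chord : Chord → ℕ
length-chord (a , b) = b ∸ a

Hidden : Chord → ℕ → Chord → Set
Hidden (a , b) v (c , d) = a ≤ c × d ≤ b × c < v × v < d × ¬ (a ≡ c × b ≡ d)

-- does (hidden? C v y) reduces to hiddenBy C v y.
hidden? : ∀ C v → Decidable (Hidden C v)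
hidden? (a , b) v (c , d) =
  a ≤? c ×-dec d ≤? b ×-dec c <? v ×-dec v <? d ×-dec ¬? (a ≟ c ×-dec b ≟ d)

hidden⇒inside : ∀ {C v y} → Hidden C v y → Inside y v
hidden⇒inside (_ , _ , c<v , v<d , _) = c<v , v<d

hidden⇒shorter : ∀ {C v y} → Hidden C v y → length-chord y < length-chord C
hidden⇒shorter {a , b} {v} {c , d} (a≤c , d≤b , c<v , v<d , C≢y) with a <? c
... | yes a<c = <-≤-trans (∸-monoʳ-< a<c c≤d) (∸-monoˡ-≤ a d≤b)
  where
  c≤d : c ≤ d
  c≤d = <⇒≤ (<-trans c<v v<d)
... | no a≮c with ≤-antisym a≤c (≮⇒≥ a≮c)
...   | refl = ∸-monoˡ-< (≤∧≢⇒< d≤b λ d≡b → C≢y (refl , sym d≡b)) (<⇒≤ (<-trans c<v v<d))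

-- When D is a dissection: v is a vertex of the cell directly below C other than its ends.
Visible : List Chord → Chord → ℕ → Set
Visible D C v = Inside C v × All (λ y → ¬ Hidden C v y) D

visible? : ∀ D C → Decidable (Visible D C)
visible? D C v = inside? C v ×-dec All.all? (λ y → ¬? (hidden? C v y)) D

not-any-hiddenBy⇔ : ∀ {C v D} → T (not (any (hiddenBy C v) D)) ⇔ All (λ y → ¬ Hidden C v y) D
not-any-hiddenBy⇔ {C} {v} {D} = mk⇔
  (λ t → All.map (λ {y} ¬T h → ¬T (Equivalence.from (T-does⇔ (hidden? C v y)) h))
                 (¬Any⇒All¬ D (Equivalence.to T-not⇔¬T t ∘ any⁺ (hiddenBy C v))))
  (λ ¬H → Equivalence.from T-not⇔¬T
     (All¬⇒¬Any (All.map (λ {y} ¬h → ¬h ∘ Equivalence.to (T-does⇔ (hidden? C v y))) ¬H)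
      ∘ any⁻ (hiddenBy C v) D))

part : List Chord → Chord → ℕ
part D C = cellSides D C ∸ 2

part≡count-visible : ∀ {D a b N} → a < b → b ≤ N →
                     part D (a , b) ≡ count (visible? D (a , b)) (upTo N)
part≡count-visible {D} {a} {b} {N} a<b b≤N = begin
  length (filter (T? ∘ unhidden) (window (a , b)))
    ≡⟨ length-filter≡count (T? ∘ unhidden) (window (a , b)) ⟩
  count (T? ∘ unhidden) (window (a , b))
    ≡⟨ count-cong (T? ∘ unhidden) (visible? D (a , b))
                  (All.map unhidden⇔visible (window-inside a<b)) ⟩
  count (visible? D (a , b)) (window (a , b))
    ≡⟨ count-upTo (visible? D (a , b)) a<b b≤N proj₁ ⟨
  count (visible? D (a , b)) (upTo N) ∎
  where
  open ≡-Reasoning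
  unhidden : ℕ → Bool
  unhidden v = not (any (hiddenBy (a , b) v) D)
  unhidden⇔visible : ∀ {v} → Inside (a , b) v → T (unhidden v) ⇔ Visible D (a , b) v
  unhidden⇔visible inside = mk⇔ (λ t → inside , Equivalence.to not-any-hiddenBy⇔ t)
                                 (Equivalence.from not-any-hiddenBy⇔ ∘ proj₂)

cellChords : ∀ {n k} → Dissection n k → List Chord
cellChords {n} Δ = (0 , n) ∷ diagonals Δ

partitionOf≡map-part : ∀ {n k} (Δ : Dissection n k) →
                       partitionOf Δ ≡ map (part (diagonals Δ)) (cellChords Δ)
partitionOf≡map-part Δ = sym (map-∘ (cellChords Δ))

cells≡map-2+-partitionOf : ∀ {n k} (Δ : Dissection n k) → cells Δ ≡ map (2 +_) (partitionOf Δ)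
cells≡map-2+-partitionOf Δ = trans (map-∘ {g = 2 +_} {f = part (diagonals Δ)} (cellChords Δ))
                                   (cong (map (2 +_)) (sym (partitionOf≡map-part Δ)))

cells-↭ : ∀ {n k} (Δ Δ′ : Dissection n k) →
          partitionOf Δ ↭ partitionOf Δ′ → cells Δ ↭ cells Δ′
cells-↭ Δ Δ′ parts↭ =
  subst₂ _↭_ (sym (cells≡map-2+-partitionOf Δ)) (sym (cells≡map-2+-partitionOf Δ′)) (↭-map⁺ (2 +_) parts↭)

module Cells {n k : ℕ} (2≤n : 2 ≤ n) (Δ : Dissection n k) where

  private
    D : List Chord
    D = diagonals Δ

  cellChord-bounds : ∀ {a b} → (a , b) ∈ cellChords Δ → suc a < b × b ≤ n
  cellChord-bounds (here refl) = 2≤n , ≤-refl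
  cellChord-bounds (there d∈D) with a+1<b , b≤n , _ ← All.lookup (areDiags Δ) d∈D = a+1<b , b≤n

  cellChord-inside-root : ∀ {C v} → C ∈ cellChords Δ → Inside C v → Inside (0 , n) v
  cellChord-inside-root {a , b} C∈ (a<v , v<b) =
    <-≤-trans z<s a<v , <-≤-trans v<b (proj₂ (cellChord-bounds C∈))

  cellChords-unique : Unique (cellChords Δ)
  cellChords-unique = All.tabulate root≢diagonal ∷ distinct Δ
    where
    root≢diagonal : ∀ {y} → y ∈ D → (0 , n) ≢ y
    root≢diagonal y∈D refl = proj₂ (proj₂ (All.lookup (areDiags Δ) y∈D)) (refl , refl)

  cellChords-nonCrossing : ∀ {C C′} → C ∈ cellChords Δ → C′ ∈ cellChords Δ → ¬ Crosses C C′
  cellChords-nonCrossing = allPairs-lookup Crosses-irrefl (λ ¬cross → ¬cross ∘ Crosses-sym)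
    (All.map root-nonCrossing (areDiags Δ) ∷ nonCrossing Δ)
    where
    root-nonCrossing : ∀ {y} → IsDiagonal n y → ¬ Crosses (0 , n) y
    root-nonCrossing (_ , d≤n , _) (inj₁ (_ , _ , n<d)) = <⇒≱ n<d d≤n

  nested-diagonal : ∀ {C C′} → C ∈ cellChords Δ → C′ ∈ cellChords Δ →
                    Nested C′ C → C′ ≢ C → C′ ∈ D
  nested-diagonal C∈ (here refl) (a≤0 , n≤b) root≢C = ⊥-elim (root≢C (cong₂ _,_
    (sym (n≤0⇒n≡0 a≤0)) (≤-antisym n≤b (proj₂ (cellChord-bounds C∈)))))
  nested-diagonal _ (there C′∈D) _ _ = C′∈D

  nested-visible : ∀ {C C′ v} → C ∈ cellChords Δ → C′ ∈ cellChords Δ →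
                   Visible D C v → Inside C′ v → Nested C′ C → C′ ≡ C
  nested-visible {a , b} {c , d} C∈ C′∈ (_ , unhidden) (c<v , v<d) (a≤c , d≤b)
    with ≡-dec _≟_ _≟_ (c , d) (a , b)
  ... | yes C′≡C = C′≡C
  ... | no C′≢C = ⊥-elim (All.lookup unhidden (nested-diagonal C∈ C′∈ (a≤c , d≤b) C′≢C)
    (a≤c , d≤b , c<v , v<d , λ (a≡c , b≡d) → C′≢C (sym (cong₂ _,_ a≡c b≡d))))

  visible-unique : ∀ {C C′ v} → C ∈ cellChords Δ → C′ ∈ cellChords Δ →
                   Visible D C v → Visible D C′ v → C ≡ C′
  visible-unique C∈ C′∈ vis vis′
    with nested-or-crossing (proj₁ vis) (proj₁ vis′) (cellChords-nonCrossing C∈ C′∈)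
  ... | inj₁ C⊆C′ = nested-visible C′∈ C∈ vis′ (proj₁ vis) C⊆C′
  ... | inj₂ C′⊆C = sym (nested-visible C∈ C′∈ vis (proj₁ vis′) C′⊆C)

  innermost-visible : ∀ {v} → Inside (0 , n) v → ∃ λ C → C ∈ cellChords Δ × Visible D C v
  innermost-visible {v} inside-root = innermost , innermost∈ , inside , All.tabulate unhidden
    where
    around : List Chord
    around = filter (λ y → inside? y v) D
    innermost : Chord
    innermost = argmin length-chord (0 , n) around
    innermost∈ : innermost ∈ cellChords Δ
    innermost∈ = [ here , there ∘ proj₁ ∘ ∈-filter⁻ (λ y → inside? y v) ]′
                   (argmin-sel length-chord (0 , n) around)
    inside : Inside innermost v
    inside = argmin-all length-chord inside-root (all-filter (λ y → inside? y v) D)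
    unhidden : ∀ {y} → y ∈ D → ¬ Hidden innermost v y
    unhidden y∈D hidden = <⇒≱ (hidden⇒shorter hidden) (All.lookup (f[argmin]≤f[xs] (0 , n) around)
      (∈-filter⁺ (λ y → inside? y v) y∈D (hidden⇒inside hidden)))

  cell-has-visible : ∀ {C} → C ∈ cellChords Δ → ∃ λ v → Visible D C v
  cell-has-visible {a , b} C∈ = proj₂ last , (a<last , last<b) , All.tabulate unhidden
    where
    StartsBelow : Chord → Set
    StartsBelow (c , d) = c ≡ a × d < b
    startsBelow? : Decidable StartsBelow
    startsBelow? (c , d) = c ≟ a ×-dec d <? b
    below : List Chord
    below = filter startsBelow? D
    last : Chord
    last = argmax proj₂ (a , suc a) below
    last-startsBelow : StartsBelow last
    last-startsBelow = argmax-all proj₂ {P = StartsBelow}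
      (refl , proj₁ (cellChord-bounds C∈)) (all-filter startsBelow? D)
    a<last : a < proj₂ last
    a<last = f[⊥]≤f[argmax] {f = proj₂} (a , suc a) below
    last<b : proj₂ last < b
    last<b = proj₂ last-startsBelow
    unhidden : ∀ {y} → y ∈ D → ¬ Hidden (a , b) (proj₂ last) y
    unhidden {c , d} y∈D (a≤c , d≤b , c<last , last<d , C≢y) with a ≟ c
    ... | yes refl = <⇒≱ last<d (All.lookup (f[xs]≤f[argmax] (a , suc a) below)
      (∈-filter⁺ startsBelow? y∈D (refl , ≤∧≢⇒< d≤b λ d≡b → C≢y (refl , sym d≡b))))
    ... | no a≢c = [ last≢a+1 , last∉below ]′ (argmax-sel proj₂ (a , suc a) below)
      where
      last≢a+1 : last ≢ (a , suc a)
      last≢a+1 last≡ = a≢c (≤-antisym a≤c (s≤s⁻¹ (subst (λ y → c < proj₂ y) last≡ c<last)))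
      last∉below : last ∉ below
      last∉below last∈ =
        cellChords-nonCrossing (there (proj₁ (∈-filter⁻ startsBelow? last∈))) (there y∈D)
        (inj₁ (subst (_< c) (sym (proj₁ last-startsBelow)) (≤∧≢⇒< a≤c a≢c) , c<last , last<d))

  cellChord-part≡count : ∀ {C} → C ∈ cellChords Δ → part D C ≡ count (visible? D C) (upTo n)
  cellChord-part≡count {a , b} C∈ with a+1<b , b≤n ← cellChord-bounds C∈ =
    part≡count-visible {D} (<-trans (n<1+n a) a+1<b) b≤n

  part-pos : ∀ {C} → C ∈ cellChords Δ → 0 < part D C
  part-pos {C} C∈ with v , vis ← cell-has-visible C∈ = subst (0 <_) (sym (cellChord-part≡count C∈))
    (count-pos (visible? D C) (lose (∈-upTo⁺ (<-≤-trans (proj₂ (proj₁ vis)) v≤n)) vis))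
    where
    v≤n : proj₂ C ≤ n
    v≤n = proj₂ (cellChord-bounds C∈)

  count-viewers : ∀ v → count (λ C → visible? D C v) (cellChords Δ) ≡ indicator (inside? (0 , n) v)
  count-viewers v = count-viewers′ (inside? (0 , n) v)
    where
    count-viewers′ : (inside-root? : Dec (Inside (0 , n) v)) →
                     count (λ C → visible? D C v) (cellChords Δ) ≡ indicator inside-root?
    count-viewers′ (yes inside-root) with C , C∈ , vis ← innermost-visible inside-root =
      count-unique (λ C → visible? D C v) cellChords-unique C∈ vis
        (λ C′∈ vis′ → visible-unique C′∈ C∈ vis′ vis)
    count-viewers′ (no outside-root) = count-none (λ C → visible? D C v)
      (All.tabulate λ C∈ vis → outside-root (cellChord-inside-root C∈ (proj₁ vis)))

  sum-parts : sum (map (part D) (cellChords Δ)) ≡ n ∸ 1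
  sum-parts = begin
    sum (map (part D) (cellChords Δ))
      ≡⟨ cong sum (map-cong-local (All.tabulate cellChord-part≡count)) ⟩
    sum (map (λ C → count (visible? D C) (upTo n)) (cellChords Δ))
      ≡⟨ sum-map-comm (λ C v → indicator (visible? D C v)) (cellChords Δ) (upTo n) ⟩
    sum (map (λ v → count (λ C → visible? D C v) (cellChords Δ)) (upTo n))
      ≡⟨ cong sum (map-cong count-viewers (upTo n)) ⟩
    count (inside? (0 , n)) (upTo n)
      ≡⟨ count-inside (<-trans z<s 2≤n) ≤-refl ⟩
    n ∸ 1 ∎
    where open ≡-Reasoning

  partitionOf-isPartition : IsPartition (n ∸ 1) (k + 1) (partitionOf Δ)
  partitionOf-isPartition =
      map⁺ (map⁺ (All.tabulate part-pos))
    , trans (length-map (_∸ 2) (cells Δ))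
            (trans (length-map (cellSides D) (cellChords Δ)) (trans (cong suc (size Δ)) (+-comm 1 k)))
    , trans (cong sum (partitionOf≡map-part Δ)) sum-parts

fan : List ℕ → List Chord
fan = map (0 ,_)

fan-nonCrossing : ∀ ds → AllPairs (λ x y → ¬ Crosses x y) (fan ds)
fan-nonCrossing [] = []
fan-nonCrossing (d ∷ ds) = map⁺ (All.universal (λ _ → fan-¬Crosses) ds) ∷ fan-nonCrossing ds
  where
  fan-¬Crosses : ∀ {d′} → ¬ Crosses (0 , d) (0 , d′)
  fan-¬Crosses (inj₁ (() , _))
  fan-¬Crosses (inj₂ (() , _))

module _ {ds : List ℕ} {l b : ℕ} (l+1∈ : suc l ∈ 1 ∷ ds) (l+1<b : suc l < b)
         (separated : ∀ {d} → d ∈ ds → d ≤ suc l ⊎ b ≤ d) where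

  fan-visible⇔ : ∀ {v} → Visible (fan ds) (0 , b) v ⇔ Inside (l , b) v
  fan-visible⇔ {v} = mk⇔ (to l+1∈) from
    where
    to : suc l ∈ 1 ∷ ds → Visible (fan ds) (0 , b) v → Inside (l , b) v
    to _ ((_ , v<b) , _) with l <? v
    ... | yes l<v = l<v , v<b
    to (here refl) ((0<v , _) , _) | no l≮v = ⊥-elim (l≮v 0<v)
    to (there l+1∈ds) ((0<v , _) , unhidden) | no l≮v =
      ⊥-elim (All.lookup unhidden (∈-map⁺ (0 ,_) l+1∈ds)
        (z≤n , <⇒≤ l+1<b , 0<v , s≤s (≮⇒≥ l≮v) , λ (_ , b≡l+1) → <⇒≢ l+1<b (sym b≡l+1)))
    from : Inside (l , b) v → Visible (fan ds) (0 , b) v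
    from (l<v , v<b) = (<-≤-trans z<s l<v , v<b) , map⁺ (All.tabulate unhidden)
      where
      unhidden : ∀ {d} → d ∈ ds → ¬ Hidden (0 , b) v (0 , d)
      unhidden d∈ds (_ , d≤b , _ , v<d , C≢y) with separated d∈ds
      ... | inj₁ d≤l+1 = <⇒≱ l<v (s≤s⁻¹ (<-≤-trans v<d d≤l+1))
      ... | inj₂ b≤d = C≢y (refl , ≤-antisym b≤d d≤b)

  fan-part : part (fan ds) (0 , b) ≡ b ∸ suc l
  fan-part = begin
    part (fan ds) (0 , b)                       ≡⟨ part≡count-visible {fan ds} (<-trans z<s l+1<b) ≤-refl ⟩
    count (visible? (fan ds) (0 , b)) (upTo b)  ≡⟨ count-cong (visible? (fan ds) (0 , b)) (inside? (l , b))
                                                     (All.universal (λ _ → fan-visible⇔) (upTo b)) ⟩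
    count (inside? (l , b)) (upTo b)            ≡⟨ count-inside (<-trans (n<1+n l) l+1<b) ≤-refl ⟩
    b ∸ suc l                                   ∎
    where open ≡-Reasoning

fanEnds : List ℕ → List ℕ
fanEnds [] = []
fanEnds (p ∷ ps) = suc (sum (p ∷ ps)) ∷ fanEnds ps

length-fanEnds : ∀ ps → length (fanEnds ps) ≡ length ps
length-fanEnds [] = refl
length-fanEnds (p ∷ ps) = cong suc (length-fanEnds ps)

sum-<-sum-∷ : ∀ {p} ps → 0 < p → sum ps < sum (p ∷ ps)
sum-<-sum-∷ {p} ps 0<p = +-monoˡ-≤ (sum ps) 0<p

fanEnds-≤ : ∀ ps → All (_≤ suc (sum ps)) (fanEnds ps)
fanEnds-≤ [] = []
fanEnds-≤ (p ∷ ps) = ≤-refl ∷ All.map (λ d≤ → ≤-trans d≤ (s≤s (m≤n+m (sum ps) p)))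
                                      (fanEnds-≤ ps)

fanEnds-decreasing : ∀ {ps} → All (0 <_) ps → AllPairs _>_ (fanEnds ps)
fanEnds-decreasing [] = []
fanEnds-decreasing {p ∷ ps} (0<p ∷ pos) =
  All.map (λ d≤ → ≤-<-trans d≤ (s<s (sum-<-sum-∷ ps 0<p))) (fanEnds-≤ ps) ∷ fanEnds-decreasing pos

fanEnds-1< : ∀ {ps} → All (0 <_) ps → All (1 <_) (fanEnds ps)
fanEnds-1< [] = []
fanEnds-1< {p ∷ ps} (0<p ∷ pos) = s<s (≤-trans 0<p (m≤m+n p (sum ps))) ∷ fanEnds-1< pos

module _ {ds : List ℕ} where

  fan-headPart : ∀ q qs → 0 < q → suc (sum qs) ∈ 1 ∷ ds →
                 (∀ {d} → d ∈ ds → d ∈ fanEnds (q ∷ qs) ⊎ suc (sum (q ∷ qs)) ≤ d) →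
                 part (fan ds) (0 , suc (sum (q ∷ qs))) ≡ q
  fan-headPart q qs 0<q lower∈ placed =
    trans (fan-part lower∈ (s<s (sum-<-sum-∷ qs 0<q)) separated) (m+n∸n≡m q (sum qs))
    where
    separated : ∀ {d} → d ∈ ds → d ≤ suc (sum qs) ⊎ suc (sum (q ∷ qs)) ≤ d
    separated d∈ds with placed d∈ds
    ... | inj₁ (here refl) = inj₂ ≤-refl
    ... | inj₁ (there d∈) = inj₁ (All.lookup (fanEnds-≤ qs) d∈)
    ... | inj₂ top≤d = inj₂ top≤d

  fan-parts : ∀ q qs → All (0 <_) (q ∷ qs) → (∀ {d} → d ∈ fanEnds qs → d ∈ ds) →
              (∀ {d} → d ∈ ds → d ∈ fanEnds (q ∷ qs) ⊎ suc (sum (q ∷ qs)) ≤ d) →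
              map (λ b → part (fan ds) (0 , b)) (fanEnds (q ∷ qs)) ≡ q ∷ qs
  fan-parts q [] (0<q ∷ []) _ placed = cong (_∷ []) (fan-headPart q [] 0<q (here refl) placed)
  fan-parts q (q′ ∷ qs) (0<q ∷ pos) tail⊆ds placed =
    cong₂ _∷_ (fan-headPart q (q′ ∷ qs) 0<q (there (tail⊆ds (here refl))) placed)
              (fan-parts q′ qs pos (tail⊆ds ∘ there) placed′)
    where
    top≤ : suc (sum (q′ ∷ qs)) ≤ suc (sum (q ∷ q′ ∷ qs))
    top≤ = <⇒≤ (s<s (sum-<-sum-∷ (q′ ∷ qs) 0<q))
    placed′ : ∀ {d} → d ∈ ds → d ∈ fanEnds (q′ ∷ qs) ⊎ suc (sum (q′ ∷ qs)) ≤ d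
    placed′ d∈ds with placed d∈ds
    ... | inj₁ (here refl) = inj₂ top≤
    ... | inj₁ (there d∈) = inj₁ d∈
    ... | inj₂ top≤d = inj₂ (≤-trans top≤ top≤d)

fanDissection : ∀ p ps → All (0 <_) (p ∷ ps) → Dissection (suc (sum (p ∷ ps))) (length ps)
fanDissection p ps pos = record
  { diagonals = fan (fanEnds ps)
  ; size = trans (length-map {B = Chord} (0 ,_) (fanEnds ps)) (length-fanEnds ps)
  ; distinct = AllPairs.map⁺ (AllPairs.map (λ d>d′ → >⇒≢ d>d′ ∘ cong proj₂)
                                           (fanEnds-decreasing (All.tail pos)))
  ; areDiags = map⁺ (All.zipWith isDiagonal (fanEnds-1< (All.tail pos) , fanEnds-≤ ps))
  ; nonCrossing = fan-nonCrossing (fanEnds ps)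
  }
  where
  d<top : ∀ {d} → d ≤ suc (sum ps) → d < suc (sum (p ∷ ps))
  d<top d≤ = ≤-<-trans d≤ (s<s (sum-<-sum-∷ ps (All.head pos)))
  isDiagonal : ∀ {d} → 1 < d × d ≤ suc (sum ps) → IsDiagonal (suc (sum (p ∷ ps))) (0 , d)
  isDiagonal (1<d , d≤) = 1<d , <⇒≤ (d<top d≤) , λ (_ , d≡top) → <⇒≢ (d<top d≤) d≡top

fan-partitionOf : ∀ p ps (pos : All (0 <_) (p ∷ ps)) → partitionOf (fanDissection p ps pos) ≡ p ∷ ps
fan-partitionOf p ps pos = begin
  partitionOf (fanDissection p ps pos)           ≡⟨ partitionOf≡map-part (fanDissection p ps pos) ⟩
  map (part D) (fan (fanEnds (p ∷ ps)))          ≡⟨ map-∘ (fanEnds (p ∷ ps)) ⟨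
  map (λ b → part D (0 , b)) (fanEnds (p ∷ ps))  ≡⟨ fan-parts p ps pos id (inj₁ ∘ there) ⟩
  p ∷ ps                                         ∎
  where
  open ≡-Reasoning
  D : List Chord
  D = fan (fanEnds ps)

partition-realised : ∀ {n k} → 0 < n → (λs : List ℕ) → IsPartition (n ∸ 1) (k + 1) λs →
                     Σ (Dissection n k) (λ Δ → partitionOf Δ ↭ λs)
partition-realised {k = k} _ [] (_ , 0≡k+1 , _) = ⊥-elim (0≢1+n (trans 0≡k+1 (+-comm k 1)))
partition-realised {n} {k} 0<n (p ∷ ps) (pos , length≡ , sum≡) =
  subst₂ (λ n k → Σ (Dissection n k) (λ Δ → partitionOf Δ ↭ p ∷ ps)) n≡ k≡
         (fanDissection p ps pos , ↭-reflexive (fan-partitionOf p ps pos))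
  where
  n≡ : suc (sum (p ∷ ps)) ≡ n
  n≡ = trans (cong suc sum≡) (m+[n∸m]≡n 0<n)
  k≡ : length ps ≡ k
  k≡ = suc-injective (trans length≡ (+-comm k 1))

theorem2p3p2 : (n k : ℕ) → 2 ≤ n → k ≤ n ∸ 2 →
    ((Δ : Dissection n k) → IsPartition (n ∸ 1) (k + 1) (partitionOf Δ))
    × ((Δ Δ′ : Dissection n k) → partitionOf Δ ↭ partitionOf Δ′ → cells Δ ↭ cells Δ′)
    × ((λs : List ℕ) → IsPartition (n ∸ 1) (k + 1) λs →
         Σ (Dissection n k) (λ Δ → partitionOf Δ ↭ λs))
theorem2p3p2 n k 2≤n _ =
    Cells.partitionOf-isPartition 2≤n
  , cells-↭
  , partition-realised (<⇒≤ 2≤n)
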